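{- For every integer $n\geq 1$, \[ \sum_{\sigma\in\mathcal{Q}_n} q^{\operatorname{lrmin}(\sigma)} x^{\operatorname{ap}(\sigma)} y^{\operatorname{even}(\sigma)}= \sum_{\pi\in \overline{\mathfrak{S}}_n}q^{\operatorname{lrmin}(\pi)} x^{\operatorname{asc}(\pi)} y^{\operatorname{mark}(\pi)}. \]
   Context: Let $[n]_2$ be the multiset $\{1,1,2,2,\dots,n,n\}$. A Stirling permutation of order $n$ is a permutation $\sigma=\sigma_1\cdots\sigma_{2n}$ of $[n]_2$ such that for each $i\in[n]$ every entry between the two occurrences of $i$ is greater than $i$; $\mathcal{Q}_n$ denotes the set of these. An ascent plateau of $\sigma\in\mathcal{Q}_n$ is an entry $\sigma_i$ with $2\le i\le 2n-1$ and $\sigma_{i-1}<\sigma_i=\sigma_{i+1}$; $\operatorname{ap}(\sigma)$ is the number of ascent plateaux. An entry $k$ of $\sigma$ is even indexed if the first occurrence of $k$ is at an even position of $\sigma$; $\operatorname{even}(\sigma)$ is the number of even indexed entries (each value $k\in[n]$ counted once). For a word $w=w_1\cdots w_m$, a left-to-right minimum is an entry $w_i$ with $i=1$ or $w_i<w_j$ for all $j<i$; $\operatorname{lrmin}(w)$ is the number of distinct values that are left-to-right minima (for Stirling permutations this is the number of values $k$ some occurrence of which is a left-to-right minimum). A marked permutation of $[n]$ is a permutation $\pi=\pi_1\cdots\pi_n$ of $[n]$ together with a choice of marks on some (possibly none) of its entries that are not left-to-right minima; left-to-right minima are never marked. $\overline{\mathfrak{S}}_n$ is the set of marked permutations of $[n]$.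 For $\pi\in\overline{\mathfrak{S}}_n$, $\operatorname{mark}(\pi)$ is the number of marked entries, and $\operatorname{lrmin}(\pi)$ and $\operatorname{asc}(\pi)$ are computed ignoring marks, where $\operatorname{asc}(\pi)$ is the number of indices $i\in\{2,\dots,n\}$ with $\pi_i>\pi_{i-1}$. -}

module Defs where

open import Algebra.Bundles using (CommutativeSemiring)
open import Data.Fin using (Fin; toℕ; _<_)
open import Data.Fin.Properties using (_≟_; _<?_; all?; any?)
open import Data.Fin.Subset using (Subset; inside; outside; _∈_; ∣_∣)
open import Data.Fin.Subset.Properties using (_∈?_)
open import Data.List using (List; []; _∷_; [_]; map; foldr; filter; allFin; cartesianProduct; cartesianProductWith)
import Data.List.Membership.Propositional as List
open import Data.List.Membership.Propositional.Properties using (∈-cartesianProductWith⁺)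
open import Data.List.Relation.Unary.All using ([])
open import Data.List.Relation.Unary.AllPairs using ([]; _∷_)
open import Data.List.Relation.Unary.Any using (here)
open import Data.List.Relation.Unary.Unique.Propositional using (Unique)
open import Data.List.Relation.Unary.Unique.Propositional.Properties using (cartesianProductWith⁺)
open import Data.Nat using (ℕ; zero; suc)
import Data.Nat as ℕ
import Data.Nat.Properties as ℕ
open import Data.Nat.Divisibility using (_∣_; _∣?_)
open import Data.Product using (_×_; _,_; ∃; proj₁; proj₂)
open import Data.Vec using (Vec; []; _∷_; lookup)
import Data.Vec as Vec
open import Data.Vec.Properties using (∷-injective)
open import Relation.Binary.PropositionalEquality using (_≡_; _≢_; refl)
open import Relation.Nullary using (¬_; Dec)
open import Relation.Nullary.Decidable using (_×-dec_; _→-dec_; ¬?)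
open import Relation.Unary using (Pred; Decidable)

private
  variable
    n m : ℕ
    A : Set

number : ∀ {p} {P : Pred (Fin n) p} → Decidable P → ℕ
number P? = Vec.count P? (Vec.allFin _)

vectors : List A → (m : ℕ) → List (Vec A m)
vectors xs zero    = [ [] ]
vectors xs (suc m) = cartesianProductWith _∷_ xs (vectors xs m)

vectors-complete : {xs : List A} → (∀ a → a List.∈ xs) → (v : Vec A m) → v List.∈ vectors xs m
vectors-complete ∈xs []      = here refl
vectors-complete ∈xs (a ∷ v) = ∈-cartesianProductWith⁺ _∷_ (∈xs a) (vectors-complete ∈xs v)

vectors-unique : {xs : List A} → Unique xs → ∀ m → Unique (vectors xs m)
vectors-unique xs! zero    = [] ∷ []
vectors-unique xs! (suc m) = cartesianProductWith⁺ _∷_ ∷-injective xs! (vectors-unique xs! m)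

-- Letters and positions are 0-based: the element k of Fin n stands for the
-- letter k + 1 of [n], and position i of Fin m for position i + 1 of the word.
Word : ℕ → ℕ → Set
Word n m = Vec (Fin n) m

EachOccurs : ℕ → Word n m → Set
EachOccurs r w = ∀ k → Vec.count (k ≟_) w ≡ r

eachOccurs? : ∀ r → Decidable (EachOccurs {n} {m} r)
eachOccurs? r w = all? λ k → Vec.count (k ≟_) w ℕ.≟ r

IsPermutation : Word n n → Set
IsPermutation = EachOccurs 1

-- Positions i < l carrying equal letters are the two occurrences of that letter.
IsStirling : Word n (2 ℕ.* n) → Set
IsStirling w = EachOccurs 2 w ×
  (∀ i j l → i < j → j < l → lookup w i ≡ lookup w l → lookup w i < lookup w j)

isStirling? : Decidable (IsStirling {n})
isStirling? w = eachOccurs? 2 w ×-dec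
  (all? λ i → all? λ j → all? λ l →
    (i <? j) →-dec ((j <? l) →-dec ((lookup w i ≟ lookup w l) →-dec (lookup w i <? lookup w j))))

𝒬 : (n : ℕ) → List (Word n (2 ℕ.* n))
𝒬 n = filter isStirling? (vectors (allFin n) (2 ℕ.* n))

IsLRMin : Word n m → Fin m → Set
IsLRMin w i = ∀ j → j < i → lookup w i < lookup w j

isLRMin? : (w : Word n m) → Decidable (IsLRMin w)
isLRMin? w i = all? λ j → (j <? i) →-dec (lookup w i <? lookup w j)

IsLRMinValue : Word n m → Fin n → Set
IsLRMinValue w k = ∃ λ i → lookup w i ≡ k × IsLRMin w i

isLRMinValue? : (w : Word n m) → Decidable (IsLRMinValue w)
isLRMinValue? w k = any? λ i → (lookup w i ≟ k) ×-dec isLRMin? w i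

lrmin : Word n m → ℕ
lrmin w = number (isLRMinValue? w)

_⋖_ : Fin m → Fin m → Set
i ⋖ j = suc (toℕ i) ≡ toℕ j

_⋖?_ : (i j : Fin m) → Dec (i ⋖ j)
i ⋖? j = suc (toℕ i) ℕ.≟ toℕ j

IsAscent : Word n m → Fin m → Set
IsAscent w i = ∃ λ h → h ⋖ i × lookup w h < lookup w i

isAscent? : (w : Word n m) → Decidable (IsAscent w)
isAscent? w i = any? λ h → (h ⋖? i) ×-dec (lookup w h <? lookup w i)

IsPlateau : Word n m → Fin m → Set
IsPlateau w i = ∃ λ j → i ⋖ j × lookup w i ≡ lookup w j

isPlateau? : (w : Word n m) → Decidable (IsPlateau w)
isPlateau? w i = any? λ j → (i ⋖? j) ×-dec (lookup w i ≟ lookup w j)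

asc : Word n m → ℕ
asc w = number (isAscent? w)

ap : Word n m → ℕ
ap w = number λ i → isAscent? w i ×-dec isPlateau? w i

IsFirstOccurrence : Word n m → Fin n → Fin m → Set
IsFirstOccurrence w k i = lookup w i ≡ k × (∀ j → j < i → lookup w j ≢ k)

isFirstOccurrence? : (w : Word n m) (k : Fin n) → Decidable (IsFirstOccurrence w k)
isFirstOccurrence? w k i =
  (lookup w i ≟ k) ×-dec (all? λ j → (j <? i) →-dec ¬? (lookup w j ≟ k))

-- Parity refers to the 1-based position suc (toℕ i).
IsEvenIndexed : Word n m → Fin n → Set
IsEvenIndexed w k = ∃ λ i → IsFirstOccurrence w k i × 2 ∣ suc (toℕ i)

isEvenIndexed? : (w : Word n m) → Decidable (IsEvenIndexed w)
isEvenIndexed? w k = any? λ i → isFirstOccurrence? w k i ×-dec (2 ∣? suc (toℕ i))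

even : Word n m → ℕ
even w = number (isEvenIndexed? w)

-- A word together with the set of its marked positions.
MarkedWord : ℕ → Set
MarkedWord n = Word n n × Subset n

IsMarkedPermutation : MarkedWord n → Set
IsMarkedPermutation (w , M) = IsPermutation w × (∀ i → i ∈ M → ¬ IsLRMin w i)

isMarkedPermutation? : Decidable (IsMarkedPermutation {n})
isMarkedPermutation? (w , M) =
  eachOccurs? 1 w ×-dec (all? λ i → (i ∈? M) →-dec ¬? (isLRMin? w i))

𝔖̄ : (n : ℕ) → List (MarkedWord n)
𝔖̄ n = filter isMarkedPermutation?
  (cartesianProduct (vectors (allFin n) n) (vectors (outside ∷ inside ∷ []) n))

underlying : MarkedWord n → Word n n
underlying = proj₁

mark : MarkedWord n → ℕ
mark (w , M) = ∣ M ∣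

-- An identity between polynomials in q, x, y with natural number coefficients
-- is an identity between their values at arbitrary elements of arbitrary
-- commutative semirings; ℕ[q,x,y] with its indeterminates is one instance.
module Values {c ℓ} (R : CommutativeSemiring c ℓ) where
  open CommutativeSemiring R public using (Carrier; _≈_; _+_; _*_; 0#)
  open import Algebra.Definitions.RawSemiring (CommutativeSemiring.rawSemiring R) public using (_^_)

  infix 5 sumOver
  sumOver : List A → (A → Carrier) → Carrier
  sumOver xs f = foldr _+_ 0# (map f xs)

  syntax sumOver xs (λ a → e) = ∑[ a ← xs ] e

{-# OPTIONS --safe #-}

-- Build the objects of order m + 1 from those of order m by inserting the
-- largest letter. In front, it only creates a new left-to-right minimum.
-- Elsewhere:
--   * for a Stirling permutation with c ascent plateaux, the number of these
--     stays the same in the 2c gaps next to an ascent plateau and grows by one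
--     in the other gaps; the two gaps next to an ascent plateau have opposite
--     parity, so that exactly half of the 2c gaps, and half of all 2m gaps,
--     make the new letter even indexed;
--   * for a marked permutation with c ascents, the number of these stays the
--     same in the c gaps at an ascent and grows by one in the other m − c,
--     and the new letter may be marked or not.
-- So the triples of statistics satisfy the same recursion (step) on both sides.
module Submission where

open import Algebra.Bundles using (CommutativeSemiring)
open import Data.Bool using (Bool; true; false; not; _∧_; _∨_; if_then_else_)
open import Data.Bool.Properties using (∧-zeroʳ; not-involutive)
open import Data.Empty using (⊥)
open import Data.Fin as Fin using (Fin; zero; suc; toℕ; fromℕ<)
open import Data.Fin.Properties as Fin using (toℕ-injective; toℕ-fromℕ<; toℕ<n)
open import Data.Fin.Subset as Subset using (Subset; inside; outside; ∣_∣)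
open import Data.List using (List; []; _∷_; _++_; map; concatMap; length; replicate; filter; allFin; cartesianProduct; foldr)
open import Data.List.Membership.Propositional using (_∈_; _∉_)
open import Data.List.Membership.Propositional.Properties
open import Data.List.Membership.Propositional.Properties.WithK using (unique∧set⇒bag)
open import Data.List.Properties using (∷-injectiveʳ; ∷-injectiveˡ; map-++; map-∘; map-cong; map-cong-local; map-replicate; map-concatMap; concatMap-map; filter-++; filter-all; filter-none; filter-accept; length-++; length-map)
open import Data.List.Relation.Binary.BagAndSetEquality using (∼bag⇒↭)
import Data.List.Relation.Binary.Permutation.Propositional as ↭
open ↭ using (_↭_; ↭-swap; ↭-refl; ↭-sym; ↭-trans; ↭-prep; ↭-reflexive; ↭⇒↭ₛ′; module PermutationReasoning)
open import Data.List.Relation.Binary.Permutation.Propositional.Properties using (shift; shifts; ++⁺; ++⁺ˡ; ++⁺ʳ) renaming (map⁺ to ↭-map⁺)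
import Data.List.Relation.Binary.Permutation.Setoid.Properties as ↭ₛ
open import Data.List.Relation.Unary.All as All using (All; []; _∷_)
import Data.List.Relation.Unary.All.Properties as All
open import Data.List.Relation.Unary.AllPairs as AllPairs using ([]; _∷_)
open import Data.List.Relation.Unary.Any as Any using (here; there)
open import Data.List.Relation.Unary.Unique.Propositional using (Unique)
import Data.List.Relation.Unary.Unique.Propositional.Properties as Unique
open import Data.Nat as ℕ using (ℕ; zero; suc; _+_; _∸_; _⊓_; _≤_; _<_; _≥_; z<s; s<s; s<s⁻¹)
open import Data.Nat.Divisibility using (_∣_; _∣?_)
open import Data.Nat.Properties
open import Data.Product using (∃; ∃₂; _×_; _,_; proj₁; proj₂)
open import Data.Sum as Sum using (_⊎_; inj₁; inj₂; [_,_]′)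
open import Data.Unit using (⊤)
open import Data.Vec as Vec using ([]; _∷_; lookup; here; there)
open import Function using (_∘_; id; _⇔_; mk⇔; module Equivalence)
open import Relation.Binary.PropositionalEquality hiding ([_])
open import Relation.Nullary using (¬_; Dec; yes; no; does; contradiction)
open import Relation.Nullary.Decidable using (dec-true; dec-false; does-⇔; _×-dec_; _⊎-dec_)
open import Relation.Unary using (Decidable)
open import Defs

private
  variable
    A B : Set
    a b k m n r : ℕ
    s t : Bool
    xs ys v w : List A

-- Inserting a block into a word

-- The front gap is left out. When copies of the largest letter are inserted, it is the only gap
-- that creates a left-to-right minimum, and so the only one where the new letter may not be marked.
inner : List A → List A → List (List A)
inner xs []      = []
inner xs (y ∷ w) = map (y ∷_) ((xs ++ w) ∷ inner xs w)

insertions : List A → List A → List (List A)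
insertions xs w = (xs ++ w) ∷ inner xs w

-- Membership in `insertions` as an inductive relation, so that proofs go by recursion on the gap.
data Insert {A : Set} (xs : List A) : List A → List A → Set where
  here  : Insert xs w (xs ++ w)
  there : ∀ {y} → Insert xs w v → Insert xs (y ∷ w) (y ∷ v)

∈-insertions⁺ : Insert xs w v → v ∈ insertions xs w
∈-insertions⁺ here      = here refl
∈-insertions⁺ (there i) = there (∈-map⁺ _ (∈-insertions⁺ i))

∈-inner⁻ : ∀ {y} → v ∈ inner xs (y ∷ w) → ∃ λ v′ → v ≡ y ∷ v′ × Insert xs w v′
∈-insertions⁻ : v ∈ insertions xs w → Insert xs w v

∈-inner⁻ {w = w} v∈ with v′ , v′∈ , refl ← ∈-map⁻ _ v∈ = v′ , refl , ∈-insertions⁻ {w = w} v′∈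

∈-insertions⁻             (here refl) = here
∈-insertions⁻ {w = y ∷ w} (there v∈) with v′ , refl , i ← ∈-inner⁻ {w = w} v∈ = there i

All-insertions : ∀ {P : List A → Set} → (∀ {v} → Insert xs w v → P v) → All P (insertions xs w)
All-insertions f = All.tabulate (f ∘ ∈-insertions⁻)

map-insertions : (f : A → B) (xs w : List A) →
                 map (map f) (insertions xs w) ≡ insertions (map f xs) (map f w)
map-inner : (f : A → B) (xs w : List A) →
            map (map f) (inner xs w) ≡ inner (map f xs) (map f w)

map-inner f xs []      = refl
map-inner f xs (y ∷ w) = begin
  map (map f) (map (y ∷_) (insertions xs w))   ≡⟨ map-∘ (insertions xs w) ⟨
  map (λ v → f y ∷ map f v) (insertions xs w)  ≡⟨ map-∘ (insertions xs w) ⟩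
  map (f y ∷_) (map (map f) (insertions xs w)) ≡⟨ cong (map (f y ∷_)) (map-insertions f xs w) ⟩
  map (f y ∷_) (insertions (map f xs) (map f w)) ∎
  where open ≡-Reasoning

map-insertions f xs w = cong₂ _∷_ (map-++ f xs w) (map-inner f xs w)

Insert-map : (f : A → B) → Insert xs w v → Insert (map f xs) (map f w) (map f v)
Insert-map {xs = xs} {w = w} f here rewrite map-++ f xs w = here
Insert-map f (there i) = there (Insert-map f i)

Insert-All⁺ : ∀ {P : A → Set} → All P xs → All P w → Insert xs w v → All P v
Insert-All⁺ pxs pw        here      = All.++⁺ pxs pw
Insert-All⁺ pxs (py ∷ pw) (there i) = py ∷ Insert-All⁺ pxs pw i

Insert-All⁻ : ∀ {P : A → Set} → Insert xs w v → All P v → All P w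
Insert-All⁻ {xs = xs} here      pv        = All.++⁻ʳ xs pv
Insert-All⁻           (there i) (py ∷ pv) = py ∷ Insert-All⁻ i pv

Insert-length : Insert xs w v → length v ≡ length xs + length w
Insert-length {xs = xs} here = length-++ xs
Insert-length {xs = xs} (there {w = w} {v = v} i) = begin
  suc (length v)               ≡⟨ cong suc (Insert-length i) ⟩
  suc (length xs + length w)   ≡⟨ +-suc (length xs) (length w) ⟨
  length xs + suc (length w)   ∎
  where open ≡-Reasoning

-- Statistics of lists of natural numbers

bit : Bool → ℕ
bit b = if b then 1 else 0

-- The largest index comes first, so that passing from `n` to `suc n` splits off the new letter `n`
-- by computation.
tally : ℕ → (ℕ → Bool) → ℕ
tally zero    f = 0
tally (suc n) f = bit (f n) + tally n f

tally-cong : ∀ n {f g} → (∀ k → k < n → f k ≡ g k) → tally n f ≡ tally n g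
tally-cong zero    f≗g = refl
tally-cong (suc n) f≗g =
  cong₂ _+_ (cong bit (f≗g n ≤-refl)) (tally-cong n λ k k<n → f≗g k (m<n⇒m<1+n k<n))

lrminAt : ℕ → List ℕ → Bool
lrminAt k []      = false
lrminAt k (a ∷ w) = does (k ≟ a) ∨ (does (k <? a) ∧ lrminAt k w)

-- The Boolean is the parity of the position of the first letter (true = even).
evenAt : Bool → ℕ → List ℕ → Bool
evenAt s k []      = false
evenAt s k (a ∷ w) = if does (k ≟ a) then s else evenAt (not s) k w

-- Here and in apFrom, p is the letter preceding the word.
ascFrom : ℕ → List ℕ → ℕ
ascFrom p []      = 0
ascFrom p (a ∷ w) = bit (does (p <? a)) + ascFrom a w

startsWith : ℕ → List ℕ → Bool
startsWith a []      = false
startsWith a (b ∷ w) = does (a ≟ b)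

apFrom : ℕ → List ℕ → ℕ
apFrom p []      = 0
apFrom p (a ∷ w) = bit (does (p <? a) ∧ startsWith a w) + apFrom a w

ascents plateaux : List ℕ → ℕ
ascents []       = 0
ascents (p ∷ w)  = ascFrom p w
plateaux []      = 0
plateaux (p ∷ w) = apFrom p w

minima : ℕ → List ℕ → ℕ
minima n w = tally n λ k → lrminAt k w

evens : ℕ → List ℕ → ℕ
evens n w = tally n λ k → evenAt false k w

-- Minima and parities under insertion of the largest letter

≟-refl : ∀ n → does (n ≟ n) ≡ true
≟-refl n = dec-true (n ≟ n) refl

≟-≢ : a ≢ b → does (a ≟ b) ≡ false
≟-≢ {a} {b} = dec-false (a ≟ b)

<?-true : a < b → does (a <? b) ≡ true
<?-true {a} {b} = dec-true (a <? b)

<?-false : ¬ a < b → does (a <? b) ≡ false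
<?-false {a} {b} = dec-false (a <? b)

lrminAt-replicate : ∀ r → k < n → lrminAt k (replicate r n ++ w) ≡ lrminAt k w
lrminAt-replicate zero    k<n = refl
lrminAt-replicate (suc r) k<n
  rewrite ≟-≢ (<⇒≢ k<n) | <?-true k<n = lrminAt-replicate r k<n

-- A letter larger than `k` neither is `k` nor prevents a later `k` from being a minimum.
lrminAt-insert : ∀ r → k < n → Insert (replicate r n) w v → lrminAt k v ≡ lrminAt k w
lrminAt-insert r k<n here = lrminAt-replicate r k<n
lrminAt-insert {k} r k<n (there {y = y} i) =
  cong (λ z → does (k ≟ y) ∨ (does (k <? y) ∧ z)) (lrminAt-insert r k<n i)

lrminAt-larger : a < n → lrminAt n (a ∷ w) ≡ false
lrminAt-larger a<n rewrite ≟-≢ (≢-sym (<⇒≢ a<n)) | <?-false (<-asym a<n) = refl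

minima-front : ∀ r n w → minima (suc n) (replicate (suc r) n ++ w) ≡ suc (minima n w)
minima-front r n w rewrite ≟-refl n =
  cong suc (tally-cong n λ k k<n → lrminAt-replicate (suc r) k<n)

minima-there : ∀ r → a < n → Insert (replicate r n) w v → minima (suc n) (a ∷ v) ≡ minima n (a ∷ w)
minima-there {a} {n} {v = v} r a<n i rewrite lrminAt-larger {w = v} a<n =
  tally-cong n λ k k<n → lrminAt-insert r k<n (there i)

-- The block has even length, so all later letters keep the parity of their position.
evenAt-insert : ∀ s → k < n → Insert (n ∷ n ∷ []) w v → evenAt s k v ≡ evenAt s k w
evenAt-insert s k<n here rewrite ≟-≢ (<⇒≢ k<n) | not-involutive s = refl
evenAt-insert {k} s k<n (there {y = y} i) with does (k ≟ y)
... | true  = refl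
... | false = evenAt-insert (not s) k<n i

-- The letter `a` takes position 1, so `v` starts at an even position; this is the `true` in
-- `evenAt true n v`.
evens-there : a < n → Insert (n ∷ n ∷ []) w v →
              evens (suc n) (a ∷ v) ≡ bit (evenAt true n v) + evens n (a ∷ w)
evens-there {a} {n} a<n i rewrite ≟-≢ (≢-sym (<⇒≢ a<n)) =
  cong (_ +_) (tally-cong n λ k k<n → evenAt-insert false k<n (there i))

evens-front : ∀ n w → evens (suc n) (n ∷ n ∷ w) ≡ evens n w
evens-front n w rewrite ≟-refl n = tally-cong n λ k k<n → evenAt-insert {w = w} false k<n here

-- Ascents under insertion

-- Normal form, up to permutation, for the values of a statistic over all gaps: `c` gaps that keep
-- it and `d` gaps that raise it.
mix : A → A → ℕ → ℕ → List A
mix x y c d = replicate c x ++ replicate d y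

map-mix : (f : A → B) (x y : A) (c d : ℕ) → map f (mix x y c d) ≡ mix (f x) (f y) c d
map-mix f x y c d = trans (map-++ f (replicate c x) (replicate d y))
  (cong₂ _++_ (map-replicate f c x) (map-replicate f d y))

ascents-insert-∷ : ∀ p a w → p < n → a < n → map (ascFrom p) (insertions (n ∷ []) (a ∷ w)) ≡
  suc (ascFrom a w) ∷ map (bit (does (p <? a)) +_) (map (ascFrom a) (insertions (n ∷ []) w))
ascents-insert-∷ {n} p a w p<n a<n = cong₂ _∷_ front
  (trans (sym (map-∘ (insertions (n ∷ []) w))) (map-∘ (insertions (n ∷ []) w)))
  where
  front : ascFrom p (n ∷ a ∷ w) ≡ suc (ascFrom a w)
  front rewrite <?-true p<n | <?-false (<-asym a<n) = refl

-- Between `p` and `a`, the letter `n` makes an ascent followed by a descent. This replaces the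
-- ascent from `p` to `a` if there was one and adds an ascent otherwise; at the end of the word an
-- ascent is added.
ascents-insert : ∀ p w → p < n → All (_< n) w → let c = ascFrom p w in
  ∃ λ d → c + d ≡ suc (length w) ×
          map (ascFrom p) (insertions (n ∷ []) w) ↭ mix c (suc c) c d
ascents-insert p [] p<n [] rewrite <?-true p<n = 1 , refl , ↭-refl
ascents-insert {n} p (a ∷ w) p<n (a<n ∷ w<n)
  rewrite ascents-insert-∷ p a w p<n a<n
  with ascents-insert a w a<n w<n | does (p <? a)
... | d , eq , perm | true = d , cong suc eq , ↭-prep _
      (↭-trans (↭-map⁺ suc perm) (↭-reflexive (map-mix suc c (suc c) c d)))
  where c = ascFrom a w
-- Here the gap before `a` raises the number, so its value moves from the front to the second block.
... | d , eq , perm | false = suc d , trans (+-suc c d) (cong suc eq) ,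
      ↭-trans (↭-prep _ (↭-trans (↭-map⁺ id perm) (↭-reflexive (map-mix id c (suc c) c d))))
              (↭-sym (shift (suc c) (replicate c c) (replicate d (suc c))))
  where c = ascFrom a w

-- Ascent plateaux and parities under insertion

-- s is the parity of the first gap (true = even).
evenGaps : Bool → List A → ℕ
evenGaps s []      = bit s
evenGaps s (_ ∷ w) = bit s + evenGaps (not s) w

-- The `m + m` gaps alternate in parity, so half of them are even whatever the parity `s` of the
-- first one.
evenGaps-odd : ∀ s (w : List A) m → suc (length w) ≡ m + m → evenGaps s w ≡ m
evenGaps-odd s []          (suc m)       eq = contradiction (trans (suc-injective eq) (+-suc m m)) λ ()
evenGaps-odd true  (_ ∷ []) (suc zero)   eq = refl
evenGaps-odd false (_ ∷ []) (suc zero)   eq = refl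
evenGaps-odd s (_ ∷ [])    (suc (suc m)) eq =
  contradiction (trans (suc-injective (suc-injective eq)) (+-suc m (suc m))) λ ()
evenGaps-odd s (_ ∷ _ ∷ w) (suc m) eq
  with ih ← evenGaps-odd s w m (suc-injective (suc-injective (trans eq (cong suc (+-suc m m))))) | s
... | true  = cong suc ih
... | false = cong suc ih

-- Both outcomes of a gap are kept together, because even and odd gaps must be counted separately
-- among those that keep and those that raise the number of ascent plateaux.
profile : ℕ → Bool → ℕ → List ℕ → List (ℕ × Bool)
profile p s n w = map (λ v → apFrom p v , evenAt s n v) (insertions (n ∷ n ∷ []) w)

-- Odd gaps first, then even ones. The same `c` in both parts expresses that the gaps next to ascent
-- plateaux are half odd and half even.
mix² : ℕ → ℕ → ℕ → List (ℕ × Bool)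
mix² c d₀ d₁ = mix (c , false) (suc c , false) c d₀ ++ mix (c , true) (suc c , true) c d₁

shift-mix : ∀ (x y : A) c d → mix x y c (suc d) ↭ y ∷ mix x y c d
shift-mix x y c d = shift y (replicate c x) (replicate d y)

-- A gap that raises the number joins `d₀` or `d₁` according to its parity `s`. Odd gaps are counted
-- as the even gaps after a switch of all parities, whence the double `not`.
addGap : ∀ s (w : List A) c d₀ d₁ → c + d₀ ≡ evenGaps (not (not s)) w → c + d₁ ≡ evenGaps (not s) w →
         ∃₂ λ e₀ e₁ → c + e₀ ≡ bit (not s) + evenGaps (not (not s)) w × c + e₁ ≡ bit s + evenGaps (not s) w ×
                      (suc c , s) ∷ mix² c d₀ d₁ ↭ mix² c e₀ e₁
addGap false w c d₀ d₁ eq₀ eq₁ = suc d₀ , d₁ , trans (+-suc c d₀) (cong suc eq₀) , eq₁ ,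
  ++⁺ʳ (mix (c , true) (suc c , true) c d₁) (↭-sym (shift-mix (c , false) (suc c , false) c d₀))
addGap true w c d₀ d₁ eq₀ eq₁ = d₀ , suc d₁ , eq₀ , trans (+-suc c d₁) (cong suc eq₁) ,
  ↭-trans (↭-sym (shift _ (mix (c , false) (suc c , false) c d₀) _))
          (++⁺ˡ (mix (c , false) (suc c , false) c d₀) (↭-sym (shift-mix (c , true) (suc c , true) c d₁)))

-- The two gaps next to the plateau give one more unchanged gap of each parity, while the plateau
-- itself adds one to the count in every later gap.
addPlateau : ∀ s c d₀ d₁ → (suc c , s) ∷ (suc c , not s) ∷ map (λ (a , t) → suc a , t) (mix² c d₀ d₁)
                           ↭ mix² (suc c) d₀ d₁
addPlateau s c d₀ d₁ = ↭-trans
  (↭-prep _ (↭-prep _ (↭-reflexive (trans (map-++ f (mix (c , false) (suc c , false) c d₀) _)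
    (cong₂ _++_ (map-mix f (c , false) (suc c , false) c d₀) (map-mix f (c , true) (suc c , true) c d₁))))))
  (lemma s)
  where
  f : ℕ × Bool → ℕ × Bool
  f (a , t) = suc a , t
  M : Bool → ℕ → List (ℕ × Bool)
  M t d = mix (suc c , t) (suc (suc c) , t) c d
  lemma : ∀ s → (suc c , s) ∷ (suc c , not s) ∷ M false d₀ ++ M true d₁ ↭ mix² (suc c) d₀ d₁
  lemma false = ↭-prep _ (↭-sym (shift _ (M false d₀) _))
  lemma true  = ↭-trans (↭-swap _ _ ↭-refl) (↭-prep _ (↭-sym (shift _ (M false d₀) _)))

-- Before `b b` the new pair removes the ascent to the plateau, and between the two letters it
-- separates them; in both cases the new plateau replaces the old one. Behind `b b` the parity is
-- `s` again.
profile-plateau : ∀ p s b w → p < b → b < n →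
  profile p s n (b ∷ b ∷ w) ≡
    let c = apFrom b w in (suc c , s) ∷ (suc c , not s) ∷ map (λ (a , t) → suc a , t) (profile b s n w)
profile-plateau {n} p s b w p<b b<n = cong₂ _∷_ front (cong₂ _∷_ middle
  (trans (sym (map-∘ (map (b ∷_) I))) (trans (sym (map-∘ I)) (trans (map-cong g-bb I) (map-∘ I)))))
  where
  I = insertions (n ∷ n ∷ []) w
  g : List ℕ → ℕ × Bool
  g v = apFrom p v , evenAt s n v
  front : g (n ∷ n ∷ b ∷ b ∷ w) ≡ (suc (apFrom b w) , s)
  front rewrite <?-true (<-trans p<b b<n) | ≟-refl n | <?-false (n≮n n) | <?-false (<-asym b<n) | <?-false (n≮n b) = refl
  middle : g (b ∷ n ∷ n ∷ b ∷ w) ≡ (suc (apFrom b w) , not s)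
  middle rewrite <?-true p<b | ≟-≢ (<⇒≢ b<n) | <?-true b<n | ≟-refl n | <?-false (n≮n n) | <?-false (<-asym b<n)
               | ≟-≢ (≢-sym (<⇒≢ b<n)) = refl
  g-bb : ∀ v → g (b ∷ b ∷ v) ≡ (suc (apFrom b v) , evenAt s n v)
  g-bb v rewrite <?-true p<b | ≟-refl b | ≟-≢ (≢-sym (<⇒≢ b<n)) | <?-false (n≮n b) | not-involutive s = refl

-- Before `a` the new pair is an additional ascent plateau, as `a` begins none that could be lost.
-- Further on, it cannot make `a` begin one, since `a` differs from `n`.
profile-gap : ∀ p s a w → p < n → a < n → does (p <? a) ∧ startsWith a w ≡ false →
  profile p s n (a ∷ w) ≡ (suc (apFrom a w) , s) ∷ profile a (not s) n w
profile-gap {n} p s a w p<n a<n no-plateau =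
  cong₂ _∷_ front (trans (sym (map-∘ I)) (map-cong-local (All-insertions λ i → g-a i)))
  where
  I = insertions (n ∷ n ∷ []) w
  g : ℕ → Bool → List ℕ → ℕ × Bool
  g p s v = apFrom p v , evenAt s n v
  front : g p s (n ∷ n ∷ a ∷ w) ≡ (suc (apFrom a w) , s)
  front rewrite <?-true p<n | <?-false (<-asym a<n) | ≟-refl n | <?-false (n≮n n) = refl
  starts : Insert (n ∷ n ∷ []) w v → does (p <? a) ∧ startsWith a v ≡ false
  starts here rewrite ≟-≢ (<⇒≢ a<n) = ∧-zeroʳ _
  starts (there i) = no-plateau
  g-a : Insert (n ∷ n ∷ []) w v → g p s (a ∷ v) ≡ g a (not s) v
  g-a i rewrite starts i | ≟-≢ (≢-sym (<⇒≢ a<n)) = refl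

-- A view: matching on `plateau` exposes the second `b` of the word.
data Plateau (p : ℕ) : ℕ → List ℕ → Set where
  plateau    : p < b → Plateau p b (b ∷ w)
  no-plateau : does (p <? a) ∧ startsWith a w ≡ false → Plateau p a w

plateau? : ∀ p a w → Plateau p a w
plateau? p a [] = no-plateau (∧-zeroʳ _)
plateau? p a (b ∷ w) with p <? a | a ≟ b
... | yes p<a | yes refl = plateau p<a
... | yes p<a | no  a≢b  = no-plateau (trans (cong (does (p <? a) ∧_) (≟-≢ a≢b)) (∧-zeroʳ _))
... | no  p≮a | _        = no-plateau (cong (_∧ does (a ≟ b)) (<?-false p≮a))

-- The gaps on both sides of the first letter of an ascent plateau do not
-- change the number of ascent plateaux, and these two gaps have different parity.
profile-mix : ∀ p s w → p < n → All (_< n) w → let c = apFrom p w in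
  ∃₂ λ d₀ d₁ → c + d₀ ≡ evenGaps (not s) w × c + d₁ ≡ evenGaps s w ×
               profile p s n w ↭ mix² c d₀ d₁
profile-mix {n} p s [] p<n [] rewrite <?-true p<n | ≟-refl n | <?-false (n≮n n) with s
... | false = 1 , 0 , refl , refl , ↭-refl
... | true  = 0 , 1 , refl , refl , ↭-refl
profile-mix p s (a ∷ w) p<n (a<n ∷ w<n) with plateau? p a w
profile-mix {n} p s (a ∷ w) p<n (a<n ∷ w<n) | no-plateau np
  rewrite np | profile-gap p s a w p<n a<n np
  with d₀ , d₁ , eq₀ , eq₁ , perm ← profile-mix a (not s) w a<n w<n
  with e₀ , e₁ , eq₀′ , eq₁′ , perm′ ← addGap s w _ d₀ d₁ eq₀ eq₁
  = e₀ , e₁ , eq₀′ , eq₁′ , ↭-trans (↭-prep _ perm) perm′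
profile-mix {n} p s (b ∷ b ∷ w) p<n (b<n ∷ _ ∷ w<n) | plateau p<b
  rewrite profile-plateau p s b w p<b b<n | <?-true p<b | ≟-refl b | <?-false (n≮n b)
  with d₀ , d₁ , eq₀ , eq₁ , perm ← profile-mix b s w b<n w<n
  = d₀ , d₁ , trans (cong suc eq₀) (lemma (not s)) , trans (cong suc eq₁) (lemma s) ,
    ↭-trans (↭-prep _ (↭-prep _ (↭-map⁺ _ perm))) (addPlateau s _ d₀ d₁)
  where
  -- Exactly one of the two gaps next to the plateau is even, whatever `s` is.
  lemma : ∀ s → suc (evenGaps s w) ≡ bit s + (bit (not s) + evenGaps (not (not s)) w)
  lemma true  = refl
  lemma false = refl

-- The common recursion for the statistics

Stats : Set
Stats = ℕ × ℕ × ℕ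

-- Half of the gaps behind the first letter: the odd or the even ones for Stirling permutations, and
-- all of them with a fixed mark for marked permutations.
branch : ℕ → ℕ → ℕ → ℕ → List Stats
branch l e c d = mix (l , c , e) (l , suc c , e) c d

-- Statistics that occur for objects of order m satisfy c ≤ m, so m ∸ c is not truncated.
step : ℕ → Stats → List Stats
step m (l , c , e) = (suc l , c , e) ∷ branch l e c (m ∸ c) ++ branch l (suc e) c (m ∸ c)

stirlingStats : ℕ → List ℕ → Stats
stirlingStats n w = minima n w , plateaux w , evens n w

stirling-step : ∀ n w → All (_< n) w → length w ≡ n + n →
  map (stirlingStats (suc n)) (insertions (n ∷ n ∷ []) w) ↭ step n (stirlingStats n w)
stirling-step zero [] _ _ = ↭-refl
stirling-step n (a ∷ w) (a<n ∷ w<n) len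
  -- A pair inserted right behind `a` starts at position 2, so the first of these gaps is even.
  with d₀ , d₁ , eq₀ , eq₁ , perm ← profile-mix a true w a<n w<n = begin
  map f ((n ∷ n ∷ a ∷ w) ∷ map (a ∷_) I)
    ≡⟨ cong₂ _∷_ front rest ⟩
  (suc l , c , e) ∷ map h (profile a true n w)
    ↭⟨ ↭-prep _ (↭-map⁺ h perm) ⟩
  (suc l , c , e) ∷ map h (mix² c d₀ d₁)
    ≡⟨ cong ((suc l , c , e) ∷_) (map-++ h (mix (c , false) (suc c , false) c d₀) _) ⟩
  (suc l , c , e) ∷ map h (mix (c , false) (suc c , false) c d₀) ++ map h (mix (c , true) (suc c , true) c d₁)
    ≡⟨ cong ((suc l , c , e) ∷_) (cong₂ _++_ (map-mix h _ _ c d₀) (map-mix h _ _ c d₁)) ⟩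
  (suc l , c , e) ∷ branch l e c d₀ ++ branch l (suc e) c d₁
    ≡⟨ cong₂ (λ d d′ → (suc l , c , e) ∷ branch l e c d ++ branch l (suc e) c d′) (gaps false eq₀) (gaps true eq₁) ⟩
  step n (l , c , e) ∎
  where
  open PermutationReasoning
  I = insertions (n ∷ n ∷ []) w
  f = stirlingStats (suc n)
  l = minima n (a ∷ w)
  c = apFrom a w
  e = evens n (a ∷ w)
  h : ℕ × Bool → Stats
  h (a , t) = l , a , bit t + e
  gaps : ∀ s {d} → c + d ≡ evenGaps s w → d ≡ n ∸ c
  -- Behind `a` there are `n` gaps of each parity, and `c` of them keep the number of ascent
  -- plateaux.
  gaps s {d} eq = trans (sym (m+n∸m≡n c d)) (cong (_∸ c) (trans eq (evenGaps-odd s w n len)))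
  front : f (n ∷ n ∷ a ∷ w) ≡ (suc l , c , e)
  front = cong₂ _,_ (minima-front 1 n (a ∷ w)) (cong₂ _,_ ap-front (evens-front n (a ∷ w)))
    where
    ap-front : apFrom n (n ∷ a ∷ w) ≡ c
    ap-front rewrite <?-false (n≮n n) | <?-false (<-asym a<n) = refl
  rest : map f (map (a ∷_) I) ≡ map h (profile a true n w)
  rest = trans (sym (map-∘ I)) (trans
    (map-cong-local (All-insertions {w = w} f-there)) (map-∘ I))
    where
    f-there : Insert (n ∷ n ∷ []) w v → f (a ∷ v) ≡ h (apFrom a v , evenAt true n v)
    f-there {v} i = cong₂ _,_ (minima-there 2 a<n i) (cong (apFrom a v ,_) (evens-there a<n i))

-- The recursion for marked words

Entry : Set
Entry = ℕ × Bool

letters : List Entry → List ℕ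
letters = map proj₁

marks : List Entry → ℕ
marks []            = 0
marks ((_ , t) ∷ w) = bit t + marks w

marks-insert : Insert ((n , t) ∷ []) w v → marks v ≡ bit t + marks w
marks-insert here = refl
marks-insert {t = t} (there {w = w} {y = _ , s} i) =
  trans (cong (bit s +_) (marks-insert i)) (x∙yz≈y∙xz (bit s) (bit t) (marks w))
  where open import Algebra.Properties.CommutativeSemigroup +-commutativeSemigroup

markedStats : ℕ → List Entry → Stats
markedStats n w = minima n (letters w) , ascents (letters w) , marks w

-- In front the new letter is a left-to-right minimum and stays unmarked; behind a smaller letter it
-- is none and may carry a mark.
markedInsertions : ℕ → List Entry → List (List Entry)
markedInsertions n w = insertions ((n , false) ∷ []) w ++ inner ((n , true) ∷ []) w

-- Behind a first letter the minima do not change and every gap adds `bit t` marks, so only the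
-- ascents vary, as described by `ascents-insert`.
inner-step : ∀ t n w → All (_< n) (letters w) → length w ≡ n →
  let l , c , e = markedStats n w in
  map (markedStats (suc n)) (inner ((n , t) ∷ []) w) ↭ branch l (bit t + e) c (n ∸ c)
inner-step t n [] _ refl = ↭-refl
inner-step t n ((a , s) ∷ w) (a<n ∷ w<n) len
  with d , eq , perm ← ascents-insert a (letters w) a<n w<n = begin
  map (markedStats (suc n)) (map ((a , s) ∷_) I)
    ≡⟨ map-∘ I ⟨
  map (λ v → markedStats (suc n) ((a , s) ∷ v)) I
    ≡⟨ map-cong-local (All-insertions {w = w} f-there) ⟩
  map (h ∘ ascFrom a ∘ letters) I
    ≡⟨ map-∘ I ⟩
  map (h ∘ ascFrom a) (map letters I)
    ≡⟨ cong (map (h ∘ ascFrom a)) (map-insertions proj₁ ((n , t) ∷ []) w) ⟩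
  map (h ∘ ascFrom a) (insertions (n ∷ []) (letters w))
    ≡⟨ map-∘ (insertions (n ∷ []) (letters w)) ⟩
  map h (map (ascFrom a) (insertions (n ∷ []) (letters w)))
    ↭⟨ ↭-map⁺ h perm ⟩
  map h (mix c (suc c) c d)
    ≡⟨ map-mix h c (suc c) c d ⟩
  branch l (bit t + e) c d
    ≡⟨ cong (branch l (bit t + e) c) d≡ ⟩
  branch l (bit t + e) c (n ∸ c) ∎
  where
  open PermutationReasoning
  I = insertions ((n , t) ∷ []) w
  l = minima n (a ∷ letters w)
  c = ascFrom a (letters w)
  e = marks ((a , s) ∷ w)
  h : ℕ → Stats
  h a = l , a , bit t + e
  f-there : Insert ((n , t) ∷ []) w v → markedStats (suc n) ((a , s) ∷ v) ≡ h (ascFrom a (letters v))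
  f-there {v} i = cong₂ _,_ (minima-there 1 a<n (Insert-map proj₁ i))
                            (cong (ascFrom a (letters v) ,_) (marks-insert (there {y = a , s} i)))
  d≡ : d ≡ n ∸ c
  d≡ = trans (sym (m+n∸m≡n c d)) (cong (_∸ c) (trans eq (trans (cong suc (length-map proj₁ w)) len)))

-- Unmarked and marked insertions give the two branches that odd and even gaps give for Stirling
-- permutations.
marked-step : ∀ n w → All (_< n) (letters w) → length w ≡ n →
  map (markedStats (suc n)) (markedInsertions n w) ↭ step n (markedStats n w)
marked-step n w w<n len = begin
  map f (((n , false) ∷ w) ∷ inner ((n , false) ∷ []) w ++ inner ((n , true) ∷ []) w)
    ≡⟨ cong₂ _∷_ front (map-++ f (inner ((n , false) ∷ []) w) _) ⟩
  (suc l , c , e) ∷ map f (inner ((n , false) ∷ []) w) ++ map f (inner ((n , true) ∷ []) w)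
    ↭⟨ ↭-prep _ (++⁺ (inner-step false n w w<n len) (inner-step true n w w<n len)) ⟩
  step n (l , c , e) ∎
  where
  open PermutationReasoning
  f = markedStats (suc n)
  l = minima n (letters w)
  c = ascents (letters w)
  e = marks w
  ascents-front : ∀ {u} → All (_< n) u → ascFrom n u ≡ ascents u
  ascents-front []         = refl
  ascents-front (a<n ∷ _) rewrite <?-false (<-asym a<n) = refl
  front : f ((n , false) ∷ w) ≡ (suc l , c , e)
  front = cong₂ _,_ (minima-front 0 n (letters w)) (cong (_, marks w) (ascents-front w<n))

-- Generating all objects by insertion

stirling : ℕ → List (List ℕ)
stirling zero    = [] ∷ []
stirling (suc n) = concatMap (insertions (n ∷ n ∷ [])) (stirling n)

marked : ℕ → List (List Entry)
marked zero    = [] ∷ []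
marked (suc n) = concatMap (markedInsertions n) (marked n)

concatMap-↭ : (f : A → List B) → xs ↭ ys → concatMap f xs ↭ concatMap f ys
concatMap-↭ f ↭.refl         = ↭-refl
concatMap-↭ f (↭.prep x p)   = ++⁺ˡ (f x) (concatMap-↭ f p)
concatMap-↭ f (↭.swap x y p) = ↭-trans (shifts (f x) (f y)) (++⁺ˡ (f y) (++⁺ˡ (f x) (concatMap-↭ f p)))
concatMap-↭ f (↭.trans p q)  = ↭-trans (concatMap-↭ f p) (concatMap-↭ f q)

concatMap-cong-↭ : {f g : A → List B} → All (λ x → f x ↭ g x) xs → concatMap f xs ↭ concatMap g xs
concatMap-cong-↭ []       = ↭-refl
concatMap-cong-↭ (p ∷ ps) = ++⁺ p (concatMap-cong-↭ ps)

All-concatMap : ∀ {P : A → Set} {Q : B → Set} {f : A → List B} →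
                (∀ {x y} → P x → y ∈ f x → Q y) → All P xs → All Q (concatMap f xs)
All-concatMap g []       = []
All-concatMap g (p ∷ ps) = All.++⁺ (All.tabulate (g p)) (All-concatMap g ps)

-- Multiplicities of letters

occ : ℕ → List ℕ → ℕ
occ k []      = 0
occ k (a ∷ w) = bit (does (k ≟ a)) + occ k w

occ-++ : ∀ k u w → occ k (u ++ w) ≡ occ k u + occ k w
occ-++ k []      w = refl
occ-++ k (a ∷ u) w = trans (cong (bit (does (k ≟ a)) +_) (occ-++ k u w))
                           (sym (+-assoc (bit (does (k ≟ a))) (occ k u) (occ k w)))

occ-insert : ∀ k → Insert xs w v → occ k v ≡ occ k xs + occ k w
occ-insert {xs = xs} {w = w} k here = occ-++ k xs w
occ-insert {xs = xs} k (there {w = w} {y = y} i) =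
  trans (cong (bit (does (k ≟ y)) +_) (occ-insert k i)) (x∙yz≈y∙xz (bit (does (k ≟ y))) (occ k xs) (occ k w))
  where open import Algebra.Properties.CommutativeSemigroup +-commutativeSemigroup

occ-replicate : ∀ r n → occ n (replicate r n) ≡ r
occ-replicate zero    n = refl
occ-replicate (suc r) n rewrite ≟-refl n = cong suc (occ-replicate r n)

occ-≢ : All (k ≢_) w → occ k w ≡ 0
occ-≢ []         = refl
occ-≢ (k≢a ∷ ps) rewrite ≟-≢ k≢a = occ-≢ ps

occ-≢⁻ : occ k w ≡ 0 → All (k ≢_) w
occ-≢⁻ {k} {[]}    eq = []
occ-≢⁻ {k} {a ∷ w} eq with k ≟ a
... | yes refl rewrite ≟-refl k = contradiction eq λ ()
... | no  k≢a  rewrite ≟-≢ k≢a = k≢a ∷ occ-≢⁻ eq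

occ-∈ : occ k w ≡ suc m → k ∈ w
occ-∈ {k} {a ∷ w} eq with k ≟ a
... | yes refl = here refl
... | no  k≢a  rewrite ≟-≢ k≢a = there (occ-∈ eq)

occ-here : ∀ w → occ n (n ∷ w) ≡ suc (occ n w)
occ-here {n} w rewrite ≟-refl n = refl

occ-there : ∀ w → n ≢ a → occ n (a ∷ w) ≡ occ n w
occ-there w n≢a rewrite ≟-≢ n≢a = refl

All-replicate : ∀ {P : A → Set} {x} r → P x → All P (replicate r x)
All-replicate zero    px = []
All-replicate (suc r) px = px ∷ All-replicate r px

-- Used with `r = 2` for Stirling permutations and `r = 1` for permutations.
Content : ℕ → ℕ → List ℕ → Set
Content r n w = All (_< n) w × (∀ k → k < n → occ k w ≡ r)

Content-insert⁺ : ∀ r → Content r n w → Insert (replicate r n) w v → Content r (suc n) v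
Content-insert⁺ {n} {w} {v} r (w<n , occ-w) i =
  Insert-All⁺ (All-replicate r ≤-refl) (All.map m<n⇒m<1+n w<n) i , λ k k<1+n → occ-v k (m<1+n⇒m<n∨m≡n k<1+n)
  where
  occ-v : ∀ k → k < n ⊎ k ≡ n → occ k v ≡ r
  occ-v k (inj₁ k<n)  = trans (occ-insert k i)
    (cong₂ _+_ (occ-≢ (All-replicate r (<⇒≢ k<n))) (occ-w k k<n))
  occ-v k (inj₂ refl) = trans (occ-insert k i)
    (trans (cong₂ _+_ (occ-replicate r k) (occ-≢ (All.map (≢-sym ∘ <⇒≢) w<n))) (+-identityʳ r))

-- The inserted block holds all `r` copies of `n`, so none remains in `w`, whose letters are then
-- below `n`.
Content-insert⁻ : ∀ r → Content r (suc n) v → Insert (replicate r n) w v → Content r n w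
Content-insert⁻ {n} {v} {w} r (v≤n , occ-v) i =
  All.zipWith (λ (a<1+n , n≢a) → ≤∧≢⇒< (m<1+n⇒m≤n a<1+n) (≢-sym n≢a))
    (Insert-All⁻ i v≤n , occ-≢⁻ {w = w} (+-cancelˡ-≡ r _ 0
      (trans (cong (_+ occ n w) (sym (occ-replicate r n)))
      (trans (sym (occ-insert n i)) (trans (occ-v n ≤-refl) (sym (+-identityʳ r))))))) ,
  λ k k<n → trans (cong (_+ occ k w) (sym (occ-≢ (All-replicate r (<⇒≢ k<n)))))
                  (trans (sym (occ-insert k i)) (occ-v k (m<n⇒m<1+n k<n)))

-- The Stirling condition

-- The Stirling condition for an `a` standing just before the word: an entry lies between two copies
-- of `a` when another `a` comes after it.
Above : ℕ → List ℕ → Set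
Above a []      = ⊤
Above a (b ∷ w) = (a ∈ w → a < b) × Above a w

Nested : List ℕ → Set
Nested []      = ⊤
Nested (a ∷ w) = Above a w × Nested w

Above-∉ : a ∉ w → Above a w
Above-∉ {w = []}    a∉w = _
Above-∉ {w = b ∷ w} a∉w = (λ a∈w → contradiction (there a∈w) a∉w) , Above-∉ (a∉w ∘ there)

Insert-∈⁺ : {a : A} → Insert xs w v → a ∈ w → a ∈ v
Insert-∈⁺ {xs = xs} here a∈w        = ∈-++⁺ʳ xs a∈w
Insert-∈⁺ (there i) (here refl)     = here refl
Insert-∈⁺ (there i) (there a∈w)     = there (Insert-∈⁺ i a∈w)

Insert-∈⁻ : {a : A} → Insert xs w v → a ∈ v → a ∈ xs ⊎ a ∈ w
Insert-∈⁻ {xs = xs} here a∈v    = ∈-++⁻ xs a∈v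
Insert-∈⁻ (there i) (here refl) = inj₂ (here refl)
Insert-∈⁻ (there i) (there a∈v) = Sum.map₂ there (Insert-∈⁻ i a∈v)

∈-pair : a ∈ n ∷ n ∷ [] → a ≡ n
∈-pair (here eq)         = eq
∈-pair (there (here eq)) = eq

Above-insert⁺ : a < n → Above a w → Insert (n ∷ n ∷ []) w v → Above a v
Above-insert⁺ a<n ab         here      = (λ _ → a<n) , (λ _ → a<n) , ab
Above-insert⁺ a<n (a<b , ab) (there i) =
  [ (λ a∈ → contradiction (∈-pair a∈) (<⇒≢ a<n)) , a<b ]′ ∘ Insert-∈⁻ i , Above-insert⁺ a<n ab i

Above-insert⁻ : Above a v → Insert (n ∷ n ∷ []) w v → Above a w
Above-insert⁻ (_ , _ , ab) here      = ab
Above-insert⁻ (a<b , ab)   (there i) = a<b ∘ Insert-∈⁺ i , Above-insert⁻ ab i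

<⇒∉ : All (_< n) w → n ∉ w
<⇒∉ w<n n∈w = <-irrefl refl (All.lookup w<n n∈w)

-- The copies of `n` are adjacent and `n` is absent from `w`, so nothing lies between them; between
-- two copies of a smaller letter, `n` is a permitted entry.
Nested-insert⁺ : All (_< n) w → Nested w → Insert (n ∷ n ∷ []) w v → Nested v
Nested-insert⁺ w<n         ne        here      =
  ((λ n∈w → contradiction n∈w (<⇒∉ w<n)) , Above-∉ (<⇒∉ w<n)) , Above-∉ (<⇒∉ w<n) , ne
Nested-insert⁺ (a<n ∷ w<n) (ab , ne) (there i) = Above-insert⁺ a<n ab i , Nested-insert⁺ w<n ne i

Nested-insert⁻ : Nested v → Insert (n ∷ n ∷ []) w v → Nested w
Nested-insert⁻ (_ , _ , ne) here      = ne
Nested-insert⁻ (ab , ne)    (there i) = Above-insert⁻ ab i , Nested-insert⁻ ne i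

-- Nothing exceeds the largest letter, so its two occurrences are adjacent.
remove-pair : All (_< suc n) v → occ n v ≡ 2 → Nested v → ∃ λ w → Insert (n ∷ n ∷ []) w v
remove-pair {n} {a ∷ v} (_ ∷ v≤n) eq (ab , ne) with n ≟ a
... | no n≢a with w , i ← remove-pair v≤n (trans (sym (occ-there v n≢a)) eq) ne = a ∷ w , there i
remove-pair {n} {_ ∷ []}    (_ ∷ _)         eq (ab , ne) | yes refl = contradiction (trans (sym (occ-here {n} [])) eq) λ ()
remove-pair {n} {_ ∷ b ∷ v} (_ ∷ b<1+n ∷ _) eq ((n∈v⇒n<b , _) , ne) | yes refl with n ≟ b
... | yes refl = v , here
... | no n≢b   = contradiction b<1+n (≤⇒≯ (n∈v⇒n<b (occ-∈
      (trans (sym (occ-there v n≢b)) (suc-injective (trans (sym (occ-here (b ∷ v))) eq))))))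

∈-concatMap : ∀ {f : A → List B} {x y} → x ∈ xs → y ∈ f x → y ∈ concatMap f xs
∈-concatMap {f = f} x∈ y∈ = ∈-concatMap⁺ f (Any.map (λ { refl → y∈ }) x∈)

Content-zero : ∀ {r} → Content r 0 w → w ≡ []
Content-zero {[]}    _            = refl
Content-zero {_ ∷ _} (() ∷ _ , _)

∈-stirling : ∀ n → Content 2 n w → Nested w → w ∈ stirling n
∈-stirling zero    co ne rewrite Content-zero co = here refl
∈-stirling (suc n) co@(v≤n , occ-v) ne with w , i ← remove-pair v≤n (occ-v n ≤-refl) ne =
  ∈-concatMap (∈-stirling n (Content-insert⁻ 2 co i) (Nested-insert⁻ ne i)) (∈-insertions⁺ i)

stirling-sound : ∀ n → All (λ w → Content 2 n w × Nested w × length w ≡ n + n) (stirling n)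
stirling-sound zero    = (([] , λ _ ()) , _ , refl) ∷ []
stirling-sound (suc n) = All-concatMap extend (stirling-sound n)
  where
  extend : Content 2 n w × Nested w × length w ≡ n + n → v ∈ insertions (n ∷ n ∷ []) w →
           Content 2 (suc n) v × Nested v × length v ≡ suc n + suc n
  extend (co , ne , len) v∈ with i ← ∈-insertions⁻ v∈ =
    Content-insert⁺ 2 co i , Nested-insert⁺ (proj₁ co) ne i ,
    trans (Insert-length i) (trans (cong (2 +_) len) (cong suc (sym (+-suc n n))))

-- Admissible marks

-- b bounds the preceding letters from below; only non-minima may be marked.
WellMarked : ℕ → List Entry → Set
WellMarked b []            = ⊤
WellMarked b ((a , t) ∷ w) = (t ≡ true → b ≤ a) × WellMarked (a ⊓ b) w

-- Since `n` is not below the bound `b`, it may carry either mark and leaves the running minimum as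
-- it is.
WellMarked-insert⁺ : b ≤ n → WellMarked b w → Insert ((n , t) ∷ []) w v → WellMarked b v
WellMarked-insert⁺ {b} {n} b≤n wm here rewrite m≥n⇒m⊓n≡n b≤n = (λ _ → b≤n) , wm
WellMarked-insert⁺ {b} b≤n (m , wm) (there {y = a , _} i) =
  m , WellMarked-insert⁺ (≤-trans (m⊓n≤n a b) b≤n) wm i

WellMarked-insert⁻ : b ≤ n → WellMarked b v → Insert ((n , t) ∷ []) w v → WellMarked b w
WellMarked-insert⁻ {b} {n} b≤n (_ , wm) here rewrite m≥n⇒m⊓n≡n b≤n = wm
WellMarked-insert⁻ {b} b≤n (m , wm) (there {y = a , _} i) =
  m , WellMarked-insert⁻ (≤-trans (m⊓n≤n a b) b≤n) wm i

-- Words of order `n` start with the bound `n`, which exceeds every letter and makes the first one a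
-- minimum. A front letter `n` lowers the bound `suc n` to just this value.
WellMarked-here⁺ : WellMarked n w → WellMarked (suc n) ((n , false) ∷ w)
WellMarked-here⁺ {n} wm rewrite m≤n⇒m⊓n≡m (n≤1+n n) = (λ ()) , wm

WellMarked-here⁻ : WellMarked (suc n) ((n , t) ∷ w) → t ≡ false × WellMarked n w
WellMarked-here⁻ {n} {false} (_ , wm) rewrite m≤n⇒m⊓n≡m (n≤1+n n) = refl , wm
WellMarked-here⁻ {n} {true}  (m , _)  = contradiction (m refl) 1+n≰n

-- The first letter lies below both initial bounds, so it is unmarked in either case and `a` becomes
-- the bound for the rest.
WellMarked-there⁺ : a < n → WellMarked n ((a , t) ∷ w) → Insert ((n , s) ∷ []) w v →
                    WellMarked (suc n) ((a , t) ∷ v)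
WellMarked-there⁺ {a} {n} a<n (m , wm) i
  rewrite m≤n⇒m⊓n≡m (<⇒≤ a<n) | m≤n⇒m⊓n≡m (m≤n⇒m≤1+n (<⇒≤ a<n)) =
  (λ eq → contradiction (m eq) (<⇒≱ a<n)) , WellMarked-insert⁺ (<⇒≤ a<n) wm i

WellMarked-there⁻ : a < n → WellMarked (suc n) ((a , t) ∷ v) → Insert ((n , s) ∷ []) w v →
                    WellMarked n ((a , t) ∷ w)
WellMarked-there⁻ {a} {n} a<n (m , wm) i
  rewrite m≤n⇒m⊓n≡m (<⇒≤ a<n) | m≤n⇒m⊓n≡m (m≤n⇒m≤1+n (<⇒≤ a<n)) =
  (λ eq → <⇒≤ (m eq)) , WellMarked-insert⁻ (<⇒≤ a<n) wm i

remove-max : occ n (letters v) ≡ 1 → ∃₂ λ w t → Insert ((n , t) ∷ []) w v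
remove-max {n} {(a , t) ∷ v} eq with n ≟ a
... | yes refl = v , t , here
... | no n≢a with w , s , i ← remove-max (trans (sym (occ-there (letters v) n≢a)) eq) = (a , t) ∷ w , s , there i

∈-markedInsertions⁺ : All (_< n) (letters w) → Insert ((n , t) ∷ []) w v → WellMarked (suc n) v →
                      v ∈ markedInsertions n w × WellMarked n w
∈-markedInsertions⁺ w<n here wm with refl , wm′ ← WellMarked-here⁻ wm = here refl , wm′
∈-markedInsertions⁺ {n} {_ ∷ w} {t} (a<n ∷ _) (there i) wm = ∈-either t i , WellMarked-there⁻ a<n wm i
  where
  ∈-either : ∀ t {y v} → Insert ((n , t) ∷ []) w v → y ∷ v ∈ markedInsertions n (y ∷ w)
  ∈-either false i = ∈-++⁺ˡ (∈-insertions⁺ (there i))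
  ∈-either true {y} i = ∈-++⁺ʳ (insertions ((n , false) ∷ []) (y ∷ w)) (∈-map⁺ _ (∈-insertions⁺ i))

∈-markedInsertions⁻ : v ∈ markedInsertions n w → ∃ λ t → Insert ((n , t) ∷ []) w v
∈-markedInsertions⁻ {n = n} {w = w} v∈ with ∈-++⁻ (insertions ((n , false) ∷ []) w) v∈
... | inj₁ v∈ˡ = false , ∈-insertions⁻ v∈ˡ
... | inj₂ v∈ʳ = true , ∈-insertions⁻ {w = w} (there v∈ʳ)

WellMarked-markedInsertions : All (_< n) (letters w) → WellMarked n w → v ∈ markedInsertions n w → WellMarked (suc n) v
WellMarked-markedInsertions {n} {w} w<n wm v∈ with ∈-++⁻ (insertions ((n , false) ∷ []) w) v∈
... | inj₁ (here refl) = WellMarked-here⁺ wm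
WellMarked-markedInsertions {n} {_ ∷ w} (a<n ∷ _) wm v∈ | inj₁ (there v∈ˡ)
  with v , refl , i ← ∈-inner⁻ {w = w} v∈ˡ = WellMarked-there⁺ a<n wm i
WellMarked-markedInsertions {n} {_ ∷ w} (a<n ∷ _) wm v∈ | inj₂ v∈ʳ
  with v , refl , i ← ∈-inner⁻ {w = w} v∈ʳ = WellMarked-there⁺ a<n wm i

∈-marked : ∀ n → Content 1 n (letters w) → WellMarked n w → w ∈ marked n
∈-marked {[]}    zero    co wm = here refl
∈-marked {_ ∷ _} zero    (() ∷ _ , _) wm
∈-marked (suc n) co@(_ , occ-v) wm with w , t , i ← remove-max (occ-v n ≤-refl)
  with co′ ← Content-insert⁻ 1 co (Insert-map proj₁ i)
  with v∈ , wm′ ← ∈-markedInsertions⁺ (proj₁ co′) i wm =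
  ∈-concatMap (∈-marked n co′ wm′) v∈

marked-sound : ∀ n → All (λ w → Content 1 n (letters w) × WellMarked n w × length w ≡ n) (marked n)
marked-sound zero    = (([] , λ _ ()) , _ , refl) ∷ []
marked-sound (suc n) = All-concatMap extend (marked-sound n)
  where
  extend : Content 1 n (letters w) × WellMarked n w × length w ≡ n → v ∈ markedInsertions n w →
           Content 1 (suc n) (letters v) × WellMarked (suc n) v × length v ≡ suc n
  extend {w} (co , wm , len) v∈ with _ , i ← ∈-markedInsertions⁻ {w = w} v∈ =
    Content-insert⁺ 1 co (Insert-map proj₁ i) , WellMarked-markedInsertions (proj₁ co) wm v∈ ,
    trans (Insert-length i) (cong suc len)

-- Equidistribution on the generated lists

-- Turns a recursion on objects into one on statistics: the statistics of the offspring of `x`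
-- depend, up to order, on `h x` alone.
map-concatMap-step : ∀ {C : Set} (f : B → C) (g : A → List B) (h : A → C) (k : C → List C) →
  All (λ x → map f (g x) ↭ k (h x)) xs → map f (concatMap g xs) ↭ concatMap k (map h xs)
map-concatMap-step {xs = xs} f g h k eqs = begin
  map f (concatMap g xs)     ≡⟨ map-concatMap f g xs ⟩
  concatMap (map f ∘ g) xs   ↭⟨ concatMap-cong-↭ eqs ⟩
  concatMap (k ∘ h) xs       ≡⟨ concatMap-map k h xs ⟨
  concatMap k (map h xs)     ∎
  where open PermutationReasoning

stirling-marked : ∀ n → map (stirlingStats n) (stirling n) ↭ map (markedStats n) (marked n)
stirling-marked zero    = ↭-refl
stirling-marked (suc n) = begin
  map (stirlingStats (suc n)) (stirling (suc n))
    ↭⟨ map-concatMap-step _ _ _ (step n)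
         (All.map (λ {w} ((w<n , _) , _ , len) → stirling-step n w w<n len) (stirling-sound n)) ⟩
  concatMap (step n) (map (stirlingStats n) (stirling n))
    ↭⟨ concatMap-↭ (step n) (stirling-marked n) ⟩
  concatMap (step n) (map (markedStats n) (marked n))
    ↭⟨ map-concatMap-step _ _ _ (step n)
         (All.map (λ {w} ((w<n , _) , _ , len) → marked-step n w w<n len) (marked-sound n)) ⟨
  map (markedStats (suc n)) (marked (suc n)) ∎
  where open PermutationReasoning

-- Absence of repetitions

-- Filtering recovers the word into which the block was inserted, so different words have disjoint
-- lists of insertions.
filter-insert : ∀ {P : A → Set} (P? : ∀ x → Dec (P x)) → All (¬_ ∘ P) xs → All P w → Insert xs w v → filter P? v ≡ w
filter-insert {xs = xs} {w = w} P? ¬pxs pw here =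
  trans (filter-++ P? xs w) (cong₂ _++_ (filter-none P? ¬pxs) (filter-all P? pw))
filter-insert P? ¬pxs (py ∷ pw) (there i) =
  trans (filter-accept P? py) (cong (_ ∷_) (filter-insert P? ¬pxs pw i))

-- The first `x` in the result reveals the gap.
insertions-unique : ∀ {x : A} → x ∉ w → Unique (insertions (x ∷ xs) w)
insertions-unique {w = []}    x∉w = [] ∷ []
insertions-unique {w = y ∷ w} x∉w =
  All.map⁺ (All.universal (λ _ eq → x∉w (here (∷-injectiveˡ eq))) _) ∷
  Unique.map⁺ ∷-injectiveʳ (insertions-unique (x∉w ∘ there))

concatMap-unique : ∀ {P : A → Set} {f : A → List B} →
  (∀ {x} → P x → Unique (f x)) → (∀ {x y z} → P x → P y → z ∈ f x → z ∈ f y → x ≡ y) →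
  All P xs → Unique xs → Unique (concatMap f xs)
concatMap-unique f! f-disjoint [] [] = []
concatMap-unique {f = f} f! f-disjoint (px ∷ pxs) (x∉xs ∷ xs!) =
  Unique.++⁺ (f! px) (concatMap-unique f! f-disjoint pxs xs!) λ (z∈x , z∈xs) →
    disjoint z∈x pxs x∉xs z∈xs
  where
  disjoint : ∀ {ys z} → z ∈ f _ → All _ ys → All (_ ≢_) ys → z ∈ concatMap f ys → ⊥
  disjoint {y ∷ ys} z∈x (py ∷ pys) (x≢y ∷ x≢ys) z∈ with ∈-++⁻ (f y) z∈
  ... | inj₁ z∈y  = x≢y (f-disjoint px py z∈x z∈y)
  ... | inj₂ z∈ys = disjoint z∈x pys x≢ys z∈ys

stirling-unique : ∀ n → Unique (stirling n)
stirling-unique zero    = [] ∷ []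
stirling-unique (suc n) = concatMap-unique {P = All (_< n)}
  (insertions-unique ∘ <⇒∉) (λ p q v∈x v∈y → trans (sym (restrict p v∈x)) (restrict q v∈y))
  (All.map (proj₁ ∘ proj₁) (stirling-sound n)) (stirling-unique n)
  where
  restrict : All (_< n) w → v ∈ insertions (n ∷ n ∷ []) w → filter (_<? n) v ≡ w
  restrict w<n v∈ = filter-insert (_<? n) (n≮n n ∷ n≮n n ∷ []) w<n (∈-insertions⁻ v∈)

marked-unique : ∀ n → Unique (marked n)
marked-unique zero    = [] ∷ []
marked-unique (suc n) = concatMap-unique {P = All (_< n) ∘ letters}
  insertions! (λ {x} {y} p q v∈x v∈y → trans (sym (restrict x p v∈x)) (restrict y q v∈y))
  (All.map (proj₁ ∘ proj₁) (marked-sound n)) (marked-unique n)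
  where
  restrict : ∀ w → All (_< n) (letters w) → v ∈ markedInsertions n w → filter ((_<? n) ∘ proj₁) v ≡ w
  restrict w w<n v∈ =
    filter-insert ((_<? n) ∘ proj₁) (n≮n n ∷ []) (All.map⁻ w<n) (proj₂ (∈-markedInsertions⁻ {w = w} v∈))
  ∉-larger : ∀ t → All (_< n) (letters w) → (n , t) ∉ w
  ∉-larger t w<n nt∈w = <⇒∉ w<n (∈-map⁺ proj₁ nt∈w)
  insertions! : All (_< n) (letters w) → Unique (markedInsertions n w)
  insertions! {w} w<n = Unique.++⁺ (insertions-unique (∉-larger false w<n))
    -- `inner` is the tail of `insertions`. Disjointness holds because all words of the first list
    -- contain `(n , false)` and none of the second does.
    (AllPairs.tail (insertions-unique (∉-larger true w<n))) λ (v∈ˡ , v∈ʳ) →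
    absurd (Insert-∈⁻ (∈-insertions⁻ {w = w} (there v∈ʳ)) (Insert-∈ˡ (∈-insertions⁻ {w = w} v∈ˡ)))
    where
    Insert-∈ˡ : ∀ {x u} → Insert (x ∷ []) u v → x ∈ v
    Insert-∈ˡ here      = here refl
    Insert-∈ˡ (there i) = there (Insert-∈ˡ i)
    absurd : (n , false) ∈ (n , true) ∷ [] ⊎ (n , false) ∈ w → ⊥
    absurd (inj₁ (here ()))
    absurd (inj₂ n∈w) = ∉-larger false w<n n∈w

-- From vectors to lists

word : Word n m → List ℕ
word []      = []
word (a ∷ w) = toℕ a ∷ word w

entries : Word n m → Subset m → List Entry
entries []      []      = []
entries (a ∷ w) (t ∷ M) = (toℕ a , t) ∷ entries w M

letters-entries : (w : Word n m) (M : Subset m) → letters (entries w M) ≡ word w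
letters-entries []      []      = refl
letters-entries (a ∷ w) (_ ∷ M) = cong (toℕ a ∷_) (letters-entries w M)

word-injective : {w w′ : Word n m} → word w ≡ word w′ → w ≡ w′
word-injective {w = []}    {[]}     _  = refl
word-injective {w = _ ∷ _} {_ ∷ _} eq =
  cong₂ _∷_ (toℕ-injective (∷-injectiveˡ eq)) (word-injective (∷-injectiveʳ eq))

entries-injective : {x y : Word n m × Subset m} →
  entries (proj₁ x) (proj₂ x) ≡ entries (proj₁ y) (proj₂ y) → x ≡ y
entries-injective {x = [] , []} {[] , []} _ = refl
entries-injective {x = a ∷ w , t ∷ M} {b ∷ w′ , s ∷ M′} eq
  with ∷-injectiveˡ eq | entries-injective {x = w , M} {w′ , M′} (∷-injectiveʳ eq)
... | eq′ | refl = cong₂ (λ a t → a ∷ w , t ∷ M) (toℕ-injective (cong proj₁ eq′)) (cong proj₂ eq′)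

word-surjective : ∀ m {v} → All (_< n) v → length v ≡ m → ∃ λ (w : Word n m) → word w ≡ v
word-surjective zero    []          _   = [] , refl
word-surjective (suc m) (a<n ∷ v<n) len
  with w , refl ← word-surjective m v<n (suc-injective len) = fromℕ< a<n ∷ w , cong (_∷ word w) (toℕ-fromℕ< a<n)

entries-surjective : ∀ m {v} → All (_< n) (letters v) → length v ≡ m →
                     ∃₂ λ (w : Word n m) (M : Subset m) → entries w M ≡ v
entries-surjective zero    {[]}          []          _   = [] , [] , refl
entries-surjective (suc m) {(_ , t) ∷ v} (a<n ∷ v<n) len
  with w , M , refl ← entries-surjective m v<n (suc-injective len) =
  fromℕ< a<n ∷ w , t ∷ M , cong (λ a → (a , t) ∷ entries w M) (toℕ-fromℕ< a<n)

≡⇔toℕ≡ : {i j : Fin n} → i ≡ j ⇔ toℕ i ≡ toℕ j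
≡⇔toℕ≡ = mk⇔ (cong toℕ) toℕ-injective

count-word : (k : Fin n) (w : Word n m) → Vec.count (k Fin.≟_) w ≡ occ (toℕ k) (word w)
count-word k []      = refl
count-word k (a ∷ w) rewrite does-⇔ ≡⇔toℕ≡ (k Fin.≟ a) (toℕ k ≟ toℕ a) with does (toℕ k ≟ toℕ a)
... | true  = cong suc (count-word k w)
... | false = count-word k w

EachOccurs⇔Content : (w : Word n m) → EachOccurs r w ⇔ Content r n (word w)
EachOccurs⇔Content {n} {r = r} w = mk⇔
  (λ eo → bounded w , λ k k<n → subst (λ k → occ k (word w) ≡ r) (toℕ-fromℕ< k<n)
                                  (trans (sym (count-word (fromℕ< k<n) w)) (eo (fromℕ< k<n))))
  (λ (_ , co) k → trans (count-word k w) (co (toℕ k) (toℕ<n k)))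
  where
  bounded : ∀ {m} (w : Word n m) → All (_< n) (word w)
  bounded []      = []
  bounded (a ∷ w) = toℕ<n a ∷ bounded w

∈-word⁺ : (w : Word n m) (i : Fin m) → toℕ (lookup w i) ∈ word w
∈-word⁺ (a ∷ w) zero    = here refl
∈-word⁺ (a ∷ w) (suc i) = there (∈-word⁺ w i)

∈-word⁻ : {a : Fin n} (w : Word n m) → toℕ a ∈ word w → ∃ λ i → a ≡ lookup w i
∈-word⁻ (b ∷ w) (here eq) = zero , toℕ-injective eq
∈-word⁻ (b ∷ w) (there a∈w) with i , eq ← ∈-word⁻ w a∈w = suc i , eq

Above⁺ : {a : Fin n} (w : Word n m) →
         (∀ j l → j Fin.< l → a ≡ lookup w l → a Fin.< lookup w j) → Above (toℕ a) (word w)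
Above⁺ []      ab = _
Above⁺ (b ∷ w) ab = (λ a∈w → let l , eq = ∈-word⁻ w a∈w in ab zero (suc l) z<s eq) ,
                    Above⁺ w (λ j l j<l → ab (suc j) (suc l) (s<s j<l))

Above⁻ : {a : Fin n} (w : Word n m) → Above (toℕ a) (word w) →
         ∀ j l → j Fin.< l → a ≡ lookup w l → a Fin.< lookup w j
Above⁻ (b ∷ w) (a<b , ab) zero    (suc l) _   refl = a<b (∈-word⁺ w l)
Above⁻ (b ∷ w) (a<b , ab) (suc j) (suc l) j<l eq   = Above⁻ w ab j l (s<s⁻¹ j<l) eq

IsNested : Word n m → Set
IsNested w = ∀ i j l → i Fin.< j → j Fin.< l → lookup w i ≡ lookup w l → lookup w i Fin.< lookup w j

Nested⁺ : (w : Word n m) → IsNested w → Nested (word w)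
Nested⁺ []      ne = _
Nested⁺ (a ∷ w) ne = Above⁺ w (λ j l j<l → ne zero (suc j) (suc l) z<s (s<s j<l)) ,
                     Nested⁺ w (λ i j l i<j j<l → ne (suc i) (suc j) (suc l) (s<s i<j) (s<s j<l))

Nested⁻ : (w : Word n m) → Nested (word w) → IsNested w
Nested⁻ (a ∷ w) (ab , ne) zero    (suc j) (suc l) i<j j<l = Above⁻ w ab j l (s<s⁻¹ j<l)
Nested⁻ (a ∷ w) (ab , ne) (suc i) (suc j) (suc l) i<j j<l = Nested⁻ w ne i j l (s<s⁻¹ i<j) (s<s⁻¹ j<l)

-- Here `b` stands for the minimum of the letters before `w`: an entry of `w` is a minimum of the
-- whole word when it is one of `w` and lies below `b`.
WellMarked⁺ : ∀ b (w : Word n m) (M : Subset m) →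
  (∀ i → i Subset.∈ M → toℕ (lookup w i) < b → ¬ IsLRMin w i) → WellMarked b (entries w M)
WellMarked⁺ b []      []      wm = _
WellMarked⁺ b (a ∷ w) (t ∷ M) wm =
  (λ { refl → ≮⇒≥ λ a<b → wm zero here a<b λ _ () }) ,
  WellMarked⁺ (toℕ a ⊓ b) w M λ i i∈M i<a⊓b min → wm (suc i) (there i∈M) (m<n⊓o⇒m<o (toℕ a) b i<a⊓b)
    λ { zero _ → m<n⊓o⇒m<n (toℕ a) b i<a⊓b ; (suc j) j<i → min j (s<s⁻¹ j<i) }

WellMarked⁻ : ∀ b (w : Word n m) (M : Subset m) → WellMarked b (entries w M) →
  ∀ i → i Subset.∈ M → toℕ (lookup w i) < b → ¬ IsLRMin w i
WellMarked⁻ b (a ∷ w) (t ∷ M) (mk , wm) zero    here        a<b min = <⇒≱ a<b (mk refl)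
WellMarked⁻ b (a ∷ w) (t ∷ M) (mk , wm) (suc i) (there i∈M) i<b min =
  WellMarked⁻ (toℕ a ⊓ b) w M wm i i∈M (⊓-pres-m< (min zero z<s) i<b) λ j j<i → min (suc j) (s<s j<i)

-- Both lists are free of repetitions and have the same elements.
map-word-𝒬 : ∀ n → map word (𝒬 n) ↭ stirling n
map-word-𝒬 n = ∼bag⇒↭ (unique∧set⇒bag
  (Unique.map⁺ word-injective (Unique.filter⁺ isStirling? (vectors-unique (Unique.allFin⁺ n) (2 ℕ.* n))))
  (stirling-unique n) (mk⇔ sound complete))
  where
  open Equivalence
  sound : ∀ {v} → v ∈ map word (𝒬 n) → v ∈ stirling n
  sound v∈ with w , w∈ , refl ← ∈-map⁻ word v∈
    with _ , eo , ne ← ∈-filter⁻ isStirling? {xs = vectors (allFin n) (2 ℕ.* n)} w∈ =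
    ∈-stirling n (to (EachOccurs⇔Content w) eo) (Nested⁺ w ne)
  complete : ∀ {v} → v ∈ stirling n → v ∈ map word (𝒬 n)
  complete v∈ with co , ne , len ← All.lookup (stirling-sound n) v∈
    with w , refl ← word-surjective (2 ℕ.* n) (proj₁ co) (trans len (cong (n +_) (sym (+-identityʳ n)))) =
    ∈-map⁺ word (∈-filter⁺ isStirling? (vectors-complete ∈-allFin w)
      (from (EachOccurs⇔Content w) co , Nested⁻ w ne))

entriesOf : MarkedWord n → List Entry
entriesOf (w , M) = entries w M

map-entries-𝔖̄ : ∀ n → map entriesOf (𝔖̄ n) ↭ marked n
map-entries-𝔖̄ n = ∼bag⇒↭ (unique∧set⇒bag
  (Unique.map⁺ entries-injective (Unique.filter⁺ isMarkedPermutation?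
    (Unique.cartesianProduct⁺ (vectors-unique (Unique.allFin⁺ n) n) (vectors-unique sides! n))))
  (marked-unique n) (mk⇔ sound complete))
  where
  open Equivalence
  sides! : Unique (outside ∷ inside ∷ [])
  sides! = ((λ ()) ∷ []) ∷ [] ∷ []
  ∈-sides : ∀ t → t ∈ outside ∷ inside ∷ []
  ∈-sides false = here refl
  ∈-sides true  = there (here refl)
  Content-entries : ∀ w M → EachOccurs 1 w ⇔ Content 1 n (letters (entries w M))
  Content-entries w M rewrite letters-entries w M = EachOccurs⇔Content w
  sound : ∀ {v} → v ∈ map entriesOf (𝔖̄ n) → v ∈ marked n
  sound v∈ with (w , M) , w∈ , refl ← ∈-map⁻ entriesOf v∈
    with _ , eo , wm ← ∈-filter⁻ isMarkedPermutation?
      {xs = cartesianProduct (vectors (allFin n) n) (vectors (outside ∷ inside ∷ []) n)} w∈ =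
    ∈-marked n (to (Content-entries w M) eo) (WellMarked⁺ n w M λ i i∈M _ → wm i i∈M)
  complete : ∀ {v} → v ∈ marked n → v ∈ map entriesOf (𝔖̄ n)
  complete v∈ with co , wm , len ← All.lookup (marked-sound n) v∈
    with w , M , refl ← entries-surjective n (proj₁ co) len =
    ∈-map⁺ entriesOf (∈-filter⁺ isMarkedPermutation?
      (∈-cartesianProduct⁺ (vectors-complete ∈-allFin w) (vectors-complete ∈-sides M))
      -- Every letter lies below the initial bound `n`, as `WellMarked⁻` requires.
      (from (Content-entries w M) co , λ i i∈M → WellMarked⁻ n w M wm i i∈M (toℕ<n (lookup w i))))

-- Translation of the statistics

trues : ∀ n → (Fin n → Bool) → ℕ
trues zero    f = 0
trues (suc n) f = bit (f zero) + trues n (f ∘ suc)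

trues-cong : ∀ n {f g} → (∀ i → f i ≡ g i) → trues n f ≡ trues n g
trues-cong zero    f≗g = refl
trues-cong (suc n) f≗g = cong₂ _+_ (cong bit (f≗g zero)) (trues-cong n (f≗g ∘ suc))

count-tabulate : ∀ {P : A → Set} (P? : Decidable P) n (f : Fin n → A) →
                 Vec.count P? (Vec.tabulate f) ≡ trues n (does ∘ P? ∘ f)
count-tabulate P? zero    f = refl
count-tabulate P? (suc n) f with does (P? (f zero))
... | true  = cong suc (count-tabulate P? n (f ∘ suc))
... | false = count-tabulate P? n (f ∘ suc)

number-trues : ∀ {P : Fin n → Set} (P? : Decidable P) {f} → (∀ i → does (P? i) ≡ f i) → number P? ≡ trues n f
number-trues {n} P? eq = trans (count-tabulate P? n id) (trues-cong n eq)

-- The two sums run in opposite directions; `tally-suc` moves the summand at 0 past the others.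
trues-tally : ∀ n f → trues n (f ∘ toℕ) ≡ tally n f
trues-tally zero    f = refl
trues-tally (suc n) f = trans (cong (bit (f 0) +_) (trues-tally n (f ∘ suc))) (tally-suc n f)
  where
  open import Algebra.Properties.CommutativeSemigroup +-commutativeSemigroup
  tally-suc : ∀ n f → bit (f 0) + tally n (f ∘ suc) ≡ tally (suc n) f
  tally-suc zero    f = refl
  tally-suc (suc n) f = trans (x∙yz≈y∙xz (bit (f 0)) (bit (f (suc n))) _) (cong (bit (f (suc n)) +_) (tally-suc n f))

lrminAt-word : (w : Word n m) (k : Fin n) → does (isLRMinValue? w k) ≡ lrminAt (toℕ k) (word w)
lrminAt-word []      k = refl
lrminAt-word (a ∷ w) k = trans
  (does-⇔ (mk⇔ to′ from′) (isLRMinValue? (a ∷ w) k) ((toℕ k ≟ toℕ a) ⊎-dec ((k Fin.<? a) ×-dec isLRMinValue? w k)))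
  (cong (λ z → does (toℕ k ≟ toℕ a) ∨ (does (toℕ k <? toℕ a) ∧ z)) (lrminAt-word w k))
  where
  to′ : IsLRMinValue (a ∷ w) k → toℕ k ≡ toℕ a ⊎ (k Fin.< a × IsLRMinValue w k)
  to′ (zero  , refl , min) = inj₁ refl
  to′ (suc i , refl , min) = inj₂ (min zero z<s , i , refl , λ j j<i → min (suc j) (s<s j<i))
  from′ : toℕ k ≡ toℕ a ⊎ (k Fin.< a × IsLRMinValue w k) → IsLRMinValue (a ∷ w) k
  from′ (inj₁ eq) = zero , toℕ-injective (sym eq) , λ _ ()
  from′ (inj₂ (k<a , i , refl , min)) =
    suc i , refl , λ { zero _ → k<a ; (suc j) j<i → min j (s<s⁻¹ j<i) }

lrmin-word : (w : Word n m) → lrmin w ≡ minima n (word w)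
lrmin-word {n} w = trans (number-trues (isLRMinValue? w) (lrminAt-word w)) (trues-tally n λ k → lrminAt k (word w))

-- The number `d` is the position of the first letter of `w` in a longer word; `d = 1` gives
-- `IsEvenIndexed`.
EvenFrom : ℕ → Word n m → Fin n → Set
EvenFrom d w k = ∃ λ i → IsFirstOccurrence w k i × 2 ∣ d + toℕ i

evenFrom? : ∀ d (w : Word n m) → Decidable (EvenFrom d w)
evenFrom? d w k = Fin.any? λ i → isFirstOccurrence? w k i ×-dec (2 ∣? d + toℕ i)

2∣?-suc : ∀ d → does (2 ∣? suc d) ≡ not (does (2 ∣? d))
2∣?-suc zero          = refl
2∣?-suc (suc zero)    = refl
-- The remainder modulo 2 computes with period two.
2∣?-suc (suc (suc d)) = 2∣?-suc d

evenAt-word : ∀ d (w : Word n m) (k : Fin n) →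
              does (evenFrom? d w k) ≡ evenAt (does (2 ∣? d)) (toℕ k) (word w)
evenAt-word d []      k = refl
evenAt-word d (a ∷ w) k with toℕ k ≟ toℕ a
... | yes eq rewrite dec-true (toℕ k ≟ toℕ a) eq =
  does-⇔ (mk⇔ to′ λ 2∣d → zero , (sym k≡a , λ _ ()) , subst (2 ∣_) (sym (+-identityʳ d)) 2∣d)
         (evenFrom? d (a ∷ w) k) (2 ∣? d)
  where
  k≡a = toℕ-injective eq
  to′ : EvenFrom d (a ∷ w) k → 2 ∣ d
  to′ (zero  , _ , 2∣d)         = subst (2 ∣_) (+-identityʳ d) 2∣d
  to′ (suc i , (_ , first) , _) = contradiction (sym k≡a) (first zero z<s)
... | no k≢a rewrite dec-false (toℕ k ≟ toℕ a) k≢a =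
  trans (does-⇔ (mk⇔ to′ from′) (evenFrom? d (a ∷ w) k) (evenFrom? (suc d) w k))
        (trans (evenAt-word (suc d) w k) (cong (λ z → evenAt z (toℕ k) (word w)) (2∣?-suc d)))
  where
  to′ : EvenFrom d (a ∷ w) k → EvenFrom (suc d) w k
  to′ (zero  , (refl , _) , _)     = contradiction refl k≢a
  to′ (suc i , (eq , first) , 2∣d) = i , (eq , λ j j<i → first (suc j) (s<s j<i)) , subst (2 ∣_) (+-suc d (toℕ i)) 2∣d
  from′ : EvenFrom (suc d) w k → EvenFrom d (a ∷ w) k
  from′ (i , (eq , first) , 2∣d) = suc i ,
    (eq , λ { zero _ refl → k≢a refl ; (suc j) j<i → first j (s<s⁻¹ j<i) }) , subst (2 ∣_) (sym (+-suc d (toℕ i))) 2∣d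

even-word : (w : Word n m) → even w ≡ evens n (word w)
even-word {n} w = trans (number-trues (isEvenIndexed? w) (evenAt-word 1 w)) (trues-tally n λ k → evenAt false k (word w))

ascent-zero : (w : Word n (suc m)) → does (isAscent? w zero) ≡ false
ascent-zero w = dec-false (isAscent? w zero) λ { (_ , () , _) }

ascent-one : ∀ p a (w : Word n m) → does (isAscent? (p ∷ a ∷ w) (suc zero)) ≡ does (toℕ p <? toℕ a)
ascent-one p a w = does-⇔ (mk⇔ (λ { (zero , _ , p<a) → p<a ; (suc _ , () , _) }) λ p<a → zero , refl , p<a)
  (isAscent? (p ∷ a ∷ w) (suc zero)) (p Fin.<? a)

ascent-suc : ∀ p (w : Word n (suc m)) i → does (isAscent? (p ∷ w) (suc (suc i))) ≡ does (isAscent? w (suc i))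
ascent-suc p w i = does-⇔ (mk⇔ (λ { (zero , () , _) ; (suc h , h⋖i , lt) → h , suc-injective h⋖i , lt })
                               λ (h , h⋖i , lt) → suc h , cong suc h⋖i , lt)
  (isAscent? (p ∷ w) (suc (suc i))) (isAscent? w (suc i))

plateau-zero : ∀ a (w : Word n m) → does (isPlateau? (a ∷ w) zero) ≡ startsWith (toℕ a) (word w)
plateau-zero a []      = refl
plateau-zero a (b ∷ w) = does-⇔
  (mk⇔ (λ { (suc zero , _ , eq) → cong toℕ eq ; (suc (suc _) , () , _) ; (zero , () , _) })
       λ eq → suc zero , refl , toℕ-injective eq)
  (isPlateau? (a ∷ b ∷ w) zero) (toℕ a ≟ toℕ b)

plateau-suc : ∀ a (w : Word n m) i → does (isPlateau? (a ∷ w) (suc i)) ≡ does (isPlateau? w i)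
plateau-suc a w i = does-⇔ (mk⇔ (λ { (zero , () , _) ; (suc j , i⋖j , eq) → j , suc-injective i⋖j , eq })
                                λ (j , i⋖j , eq) → suc j , cong suc i⋖j , eq)
  (isPlateau? (a ∷ w) (suc i)) (isPlateau? w i)

ascFrom-word : ∀ p (w : Word n m) → trues m (λ i → does (isAscent? (p ∷ w) (suc i))) ≡ ascFrom (toℕ p) (word w)
ascFrom-word p []      = refl
ascFrom-word p (a ∷ w) = cong₂ _+_ (cong bit (ascent-one p a w))
  (trans (trues-cong _ (ascent-suc p (a ∷ w))) (ascFrom-word a w))

asc-word : (w : Word n m) → asc w ≡ ascents (word w)
asc-word []      = refl
asc-word (p ∷ w) = trans (number-trues (isAscent? (p ∷ w)) λ _ → refl)
  (trans (cong (λ z → bit z + trues _ (does ∘ isAscent? (p ∷ w) ∘ suc)) (ascent-zero (p ∷ w))) (ascFrom-word p w))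

apFrom-word : ∀ p (w : Word n m) →
  trues m (λ i → does (isAscent? (p ∷ w) (suc i)) ∧ does (isPlateau? (p ∷ w) (suc i))) ≡ apFrom (toℕ p) (word w)
apFrom-word p []      = refl
apFrom-word p (a ∷ w) = cong₂ _+_
  (cong bit (cong₂ _∧_ (ascent-one p a w) (trans (plateau-suc p (a ∷ w) zero) (plateau-zero a w))))
  (trans (trues-cong _ λ i → cong₂ _∧_ (ascent-suc p (a ∷ w) i) (plateau-suc p (a ∷ w) (suc i))) (apFrom-word a w))

ap-word : (w : Word n m) → ap w ≡ plateaux (word w)
ap-word []      = refl
ap-word (p ∷ w) = trans (number-trues (λ i → isAscent? (p ∷ w) i ×-dec isPlateau? (p ∷ w) i) λ _ → refl)
  (trans (cong (λ z → bit (z ∧ does (isPlateau? (p ∷ w) zero)) +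
                 trues _ (λ i → does (isAscent? (p ∷ w) (suc i)) ∧ does (isPlateau? (p ∷ w) (suc i))))
               (ascent-zero (p ∷ w)))
         (apFrom-word p w))

mark-entries : (w : Word n m) (M : Subset m) → ∣ M ∣ ≡ marks (entries w M)
mark-entries []      []          = refl
mark-entries (_ ∷ w) (true ∷ M)  = cong suc (mark-entries w M)
mark-entries (_ ∷ w) (false ∷ M) = mark-entries w M

stirlingStats-word : (σ : Word n m) → (lrmin σ , ap σ , even σ) ≡ stirlingStats n (word σ)
stirlingStats-word σ = cong₂ _,_ (lrmin-word σ) (cong₂ _,_ (ap-word σ) (even-word σ))

markedStats-entries : (π : MarkedWord n) →
  (lrmin (underlying π) , asc (underlying π) , mark π) ≡ markedStats n (entriesOf π)
markedStats-entries (w , M) rewrite letters-entries w M =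
  cong₂ _,_ (lrmin-word w) (cong₂ _,_ (asc-word w) (mark-entries w M))

-- Joint distribution and generating functions

stats-↭ : ∀ n → map (λ σ → lrmin σ , ap σ , even σ) (𝒬 n) ↭
                map (λ π → lrmin (underlying π) , asc (underlying π) , mark π) (𝔖̄ n)
stats-↭ n = begin
  map (λ σ → lrmin σ , ap σ , even σ) (𝒬 n)    ≡⟨ map-cong stirlingStats-word (𝒬 n) ⟩
  map (stirlingStats n ∘ word) (𝒬 n)           ≡⟨ map-∘ (𝒬 n) ⟩
  map (stirlingStats n) (map word (𝒬 n))       ↭⟨ ↭-map⁺ (stirlingStats n) (map-word-𝒬 n) ⟩
  map (stirlingStats n) (stirling n)           ↭⟨ stirling-marked n ⟩
  map (markedStats n) (marked n)               ↭⟨ ↭-map⁺ (markedStats n) (map-entries-𝔖̄ n) ⟨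
  map (markedStats n) (map entriesOf (𝔖̄ n))    ≡⟨ map-∘ (𝔖̄ n) ⟨
  map (markedStats n ∘ entriesOf) (𝔖̄ n)        ≡⟨ map-cong markedStats-entries (𝔖̄ n) ⟨
  map (λ π → lrmin (underlying π) , asc (underlying π) , mark π) (𝔖̄ n) ∎
  where open PermutationReasoning

theorem1 : ∀ {c ℓ} (R : CommutativeSemiring c ℓ) → let open Values R in
    (q x y : Carrier) (n : ℕ) → n ≥ 1 →
    (∑[ σ ← 𝒬 n ] q ^ lrmin σ * x ^ ap σ * y ^ even σ) ≈
    (∑[ π ← 𝔖̄ n ] q ^ lrmin (underlying π) * x ^ asc (underlying π) * y ^ mark π)
theorem1 R q x y n _ = begin
  foldr R._+_ R.0# (map (λ σ → q ^ lrmin σ R.* x ^ ap σ R.* y ^ even σ) (𝒬 n))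
    ≡⟨ cong sum (map-∘ (𝒬 n)) ⟩
  sum (map weight (map (λ σ → lrmin σ , ap σ , even σ) (𝒬 n)))
    -- A sum in a commutative monoid does not depend on the order of its terms, so equal multisets
    -- of triples give equal sums of weights.
    ≈⟨ ↭ₛ.foldr-commMonoid R.setoid R.+-isCommutativeMonoid
         (↭⇒↭ₛ′ R.isEquivalence (↭-map⁺ weight (stats-↭ n))) ⟩
  sum (map weight (map (λ π → lrmin (underlying π) , asc (underlying π) , mark π) (𝔖̄ n)))
    ≡⟨ cong sum (map-∘ (𝔖̄ n)) ⟨
  foldr R._+_ R.0# (map (λ π → q ^ lrmin (underlying π) R.* x ^ asc (underlying π) R.* y ^ mark π) (𝔖̄ n)) ∎
  where
  module R = CommutativeSemiring R
  open Values R using (_^_)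
  open import Relation.Binary.Reasoning.Setoid R.setoid
  sum : List R.Carrier → R.Carrier
  sum = foldr R._+_ R.0#
  weight : Stats → R.Carrier
  weight (l , c , e) = q ^ l R.* x ^ c R.* y ^ e
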